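{- Every digraph $G$ with $n$ vertices and minimum outdegree at least $22$ has a stable set with at least $\frac{n}{3}$ vertices.
   Context: Digraphs are finite, with no loops and no parallel arcs (a pair of oppositely directed arcs $uv$ and $vu$ is allowed). A set $T$ of vertices in a digraph $G$ is a stable set if for each vertex $v\in T$, at most half the out-neighbours of $v$ (in $G$) are also in $T$. (This is not the usual notion of an independent set.) -}

module Defs where

open import Data.Nat using (ℕ; _*_; _≤_)
open import Data.Fin using (Fin)
open import Data.Fin.Subset using (Subset; _∈_; _∉_; _∩_; ∣_∣)

-- The out-neighbours of each vertex form a set, so there is at most one arc
-- from u to v; arcs u → v and v → u may both be present.
record Digraph (n : ℕ) : Set where
  field
    outNbrs  : Fin n → Subset n
    loopless : ∀ v → v ∉ outNbrs v

  outdegree : Fin n → ℕ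
  outdegree v = ∣ outNbrs v ∣

open Digraph public

MinOutdegree≥ : ∀ {n} → Digraph n → ℕ → Set
MinOutdegree≥ G d = ∀ v → d ≤ outdegree G v

-- "At most half" is cleared of denominators.
Stable : ∀ {n} → Digraph n → Subset n → Set
Stable G T = ∀ v → v ∈ T → 2 * ∣ outNbrs G v ∩ T ∣ ≤ outdegree G v

{-# OPTIONS --safe #-}
-- Put each vertex independently into a random set A with probability 3/8, and
-- let T consist of the v ∈ A with at most half of their out-neighbours in A.
-- Then T is stable because T ⊆ A. As v is not its own out-neighbour, v lies in
-- T with probability (3/8) P(Bin(d, 3/8) ≤ d/2), where d is the outdegree of v.
-- This is at least 1/3 for d = 23, does not decrease along odd d, and is at
-- least as large for d = 2k as for d = 2k + 1. So E|T| ≥ n/3.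
--
-- All probabilities are scaled to natural numbers: an element has weight 3 for
-- being chosen and 5 for not being chosen, so n choices have total weight 8 ^ n.
module Submission where

open import Defs
open import Data.Bool using (Bool; true; false; _∧_) renaming (T to So)
open import Data.Bool.Properties using (∧-identityʳ; ∧-zeroʳ)
open import Data.Empty using (⊥-elim)
open import Data.Fin using (Fin; zero; suc)
open import Data.Fin.Subset using (Subset; inside; outside; _∈_; _∉_; _⊆_; _∩_; ∣_∣)
open import Data.Fin.Subset.Properties using (p⊆q⇒∣p∣≤∣q∣; x∈p∩q⁺; x∈p∩q⁻)
open import Data.Nat using (ℕ; zero; suc; _+_; _*_; _^_; _≤_; _<_; _∸_; _<ᵇ_; _≤?_; s≤s; z≤n)
open import Data.Nat.Combinatorics using (_C_; nCk≡nC[n∸k]; nCk+nC[k+1]≡[n+1]C[k+1])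
open import Data.Nat.Properties
open import Data.Nat.Tactic.RingSolver using (solve-∀)
open import Data.Product using (Σ-syntax; _×_; _,_; proj₁; proj₂)
open import Data.Sum using (_⊎_; inj₁; inj₂)
open import Data.Unit using (tt)
open import Data.Vec using ([]; _∷_; lookup; tabulate; here; there)
open import Data.Vec.Properties using ([]=⇒lookup; lookup⇒[]=; lookup∘tabulate)
open import Function using (_∘_)
open import Relation.Binary.PropositionalEquality
  using (_≡_; refl; sym; trans; cong; cong₂; subst; module ≡-Reasoning)
open import Relation.Nullary using (yes; no)

-- Binomial weights

-- 8 ^ d · P(Bin(d, 3/8) = j), by conditioning on one trial.
weight : ℕ → ℕ → ℕ
weight zero    zero    = 1
weight zero    (suc j) = 0
weight (suc d) zero    = 5 * weight d zero
weight (suc d) (suc j) = 3 * weight d j + 5 * weight d (suc j)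

-- 8 ^ d · P(Bin(d, 3/8) < j). The strict bound fits `_<ᵇ_`, and the recursion on one trial fits
-- that of `𝔼`.
weightBelow : ℕ → ℕ → ℕ
weightBelow d       zero    = 0
weightBelow zero    (suc j) = 1
weightBelow (suc d) (suc j) = 3 * weightBelow d j + 5 * weightBelow d (suc j)

weightBelow-suc : ∀ d j → weightBelow d (suc j) ≡ weightBelow d j + weight d j
weightBelow-suc zero    zero    = refl
weightBelow-suc zero    (suc j) = refl
weightBelow-suc (suc d) zero    = cong (5 *_) (weightBelow-suc d zero)
weightBelow-suc (suc d) (suc j) = trans
  (cong₂ (λ x y → 3 * x + 5 * y) (weightBelow-suc d j) (weightBelow-suc d (suc j)))
  (regroup (weightBelow d j) (weight d j) (weightBelow d (suc j)) (weight d (suc j)))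
  where
  regroup : ∀ a x b y → 3 * (a + x) + 5 * (b + y) ≡ (3 * a + 5 * b) + (3 * x + 5 * y)
  regroup = solve-∀

weightBelow-mono : ∀ d j → weightBelow d j ≤ weightBelow d (suc j)
weightBelow-mono d j =
  ≤-trans (m≤m+n _ (weight d j)) (≤-reflexive (sym (weightBelow-suc d j)))

-- The factor 5 ^ j replaces the exponent d ∸ j, so that j > d is no exception.
weight-closed : ∀ d j → weight d j * 5 ^ j ≡ (d C j) * 3 ^ j * 5 ^ d
weight-closed zero    zero    = refl
weight-closed zero    (suc j) = refl
weight-closed (suc d) zero    = trans
  (*-assoc 5 (weight d 0) 1)
  (trans (cong (5 *_) (weight-closed d 0)) (regroup (5 ^ d)))
  where
  regroup : ∀ p → 5 * (1 * 1 * p) ≡ 1 * 1 * (5 * p)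
  regroup = solve-∀
weight-closed (suc d) (suc j) = begin
  (3 * weight d j + 5 * weight d (suc j)) * (5 * 5 ^ j)
    ≡⟨ expand (weight d j) (weight d (suc j)) (5 ^ j) ⟩
  15 * (weight d j * 5 ^ j) + 5 * (weight d (suc j) * 5 ^ suc j)
    ≡⟨ cong₂ (λ x y → 15 * x + 5 * y) (weight-closed d j) (weight-closed d (suc j)) ⟩
  15 * ((d C j) * 3 ^ j * 5 ^ d) + 5 * ((d C suc j) * 3 ^ suc j * 5 ^ d)
    ≡⟨ collect (d C j) (d C suc j) (3 ^ j) (5 ^ d) ⟩
  (d C j + d C suc j) * 3 ^ suc j * 5 ^ suc d
    ≡⟨ cong (λ c → c * 3 ^ suc j * 5 ^ suc d) (nCk+nC[k+1]≡[n+1]C[k+1] d j) ⟩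
  (suc d C suc j) * 3 ^ suc j * 5 ^ suc d ∎
  where
  open ≡-Reasoning
  expand : ∀ x y p → (3 * x + 5 * y) * (5 * p) ≡ 15 * (x * p) + 5 * (y * (5 * p))
  expand = solve-∀
  collect : ∀ x y t p →
    15 * (x * t * p) + 5 * (y * (3 * t) * p) ≡ (x + y) * (3 * t) * (5 * p)
  collect = solve-∀

-- Evaluates weightBelow without its exponentially branching recursion, which
-- makes the numerical base case of lowerHalf-odd feasible.
scaledBelow : ℕ → ℕ → ℕ
scaledBelow d zero    = 0
scaledBelow d (suc j) = 5 * (scaledBelow d j + (d C j) * 3 ^ j)

weightBelow-closed : ∀ d j → weightBelow d j * 5 ^ j ≡ scaledBelow d j * 5 ^ d
weightBelow-closed d zero    = refl
weightBelow-closed d (suc j) = begin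
  weightBelow d (suc j) * 5 ^ suc j
    ≡⟨ cong (_* 5 ^ suc j) (weightBelow-suc d j) ⟩
  (weightBelow d j + weight d j) * (5 * 5 ^ j)
    ≡⟨ expand (weightBelow d j) (weight d j) (5 ^ j) ⟩
  5 * (weightBelow d j * 5 ^ j + weight d j * 5 ^ j)
    ≡⟨ cong₂ (λ x y → 5 * (x + y)) (weightBelow-closed d j) (weight-closed d j) ⟩
  5 * (scaledBelow d j * 5 ^ d + (d C j) * 3 ^ j * 5 ^ d)
    ≡⟨ collect (scaledBelow d j) ((d C j) * 3 ^ j) (5 ^ d) ⟩
  scaledBelow d (suc j) * 5 ^ d ∎
  where
  open ≡-Reasoning
  expand : ∀ b w p → (b + w) * (5 * p) ≡ 5 * (b * p + w * p)
  expand = solve-∀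
  collect : ∀ s c q → 5 * (s * q + c * q) ≡ 5 * (s + c) * q
  collect = solve-∀

-- P(Bin(d, 3/8) < j) ≥ 8/9, where 8/9 is the quotient of 1/3 by 3/8.
Likely : ℕ → ℕ → Set
Likely d j = 8 ^ suc d ≤ 9 * weightBelow d j

scaledBelow⇒Likely : ∀ d j → 8 ^ suc d * 5 ^ j ≤ 9 * (scaledBelow d j * 5 ^ d) → Likely d j
scaledBelow⇒Likely d j h = *-cancelʳ-≤ _ _ (5 ^ j) {{m^n≢0 5 j}} (begin
  8 ^ suc d * 5 ^ j               ≤⟨ h ⟩
  9 * (scaledBelow d j * 5 ^ d)   ≡⟨ cong (9 *_) (weightBelow-closed d j) ⟨
  9 * (weightBelow d j * 5 ^ j)   ≡⟨ *-assoc 9 (weightBelow d j) (5 ^ j) ⟨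
  9 * weightBelow d j * 5 ^ j     ∎)
  where open ≤-Reasoning

-- Binomial tails cut at half the number of trials

middle-C : ∀ k → suc (k * 2) C k ≡ suc (k * 2) C suc k
middle-C k = trans (nCk≡nC[n∸k] k≤) (cong (suc (k * 2) C_) diff)
  where
  double : ∀ k → suc (k * 2) ≡ suc k + k
  double = solve-∀
  k≤ : k ≤ suc (k * 2)
  k≤ = ≤-trans (m≤n+m k (suc k)) (≤-reflexive (sym (double k)))
  diff : suc (k * 2) ∸ k ≡ suc k
  diff = trans (cong (_∸ k) (double k)) (m+n∸n≡m (suc k) k)

-- The two central binomial coefficients of an odd row agree, so the weights differ only by the odds
-- 3 : 5 of a single trial.
middle-weight : ∀ k → 5 * weight (suc (k * 2)) (suc k) ≡ 3 * weight (suc (k * 2)) k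
middle-weight k = *-cancelʳ-≡ _ _ (5 ^ k) {{m^n≢0 5 k}} (begin
  5 * weight d (suc k) * 5 ^ k       ≡⟨ shift (weight d (suc k)) (5 ^ k) ⟩
  weight d (suc k) * 5 ^ suc k       ≡⟨ weight-closed d (suc k) ⟩
  (d C suc k) * 3 ^ suc k * 5 ^ d    ≡⟨ cong (λ c → c * 3 ^ suc k * 5 ^ d) (middle-C k) ⟨
  (d C k) * 3 ^ suc k * 5 ^ d        ≡⟨ pull (d C k) (3 ^ k) (5 ^ d) ⟩
  3 * ((d C k) * 3 ^ k * 5 ^ d)      ≡⟨ cong (3 *_) (weight-closed d k) ⟨
  3 * (weight d k * 5 ^ k)           ≡⟨ *-assoc 3 (weight d k) (5 ^ k) ⟨
  3 * weight d k * 5 ^ k             ∎)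
  where
  open ≡-Reasoning
  d = suc (k * 2)
  shift : ∀ x p → 5 * x * p ≡ x * (5 * p)
  shift = solve-∀
  pull : ∀ c t p → c * (3 * t) * p ≡ 3 * (c * t * p)
  pull = solve-∀

-- Two more trials turn success X ≤ k into failure only from X = k, with
-- probability 9/64, and failure into success only from X = k + 1, with
-- probability 25/64; the latter gain is larger by middle-weight.
lowerHalf-step : ∀ k →
  64 * weightBelow (suc (k * 2)) (suc k) ≤ weightBelow (suc (suc k * 2)) (suc (suc k))
lowerHalf-step k = begin
  64 * weightBelow d (suc k)
    ≡⟨ cong (64 *_) (weightBelow-suc d k) ⟩
  64 * (b + x)
    -- Gain minus loss: 25 `y` = 15 `x` is gained and 9 `x` is lost.
    ≤⟨ m≤m+n _ (6 * x) ⟩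
  64 * (b + x) + 6 * x
    ≡⟨ split b x ⟩
  64 * b + 55 * x + 5 * (3 * x)
    ≡⟨ cong (λ z → 64 * b + 55 * x + 5 * z) (middle-weight k) ⟨
  64 * b + 55 * x + 5 * (5 * y)
    ≡⟨ unstep b x y ⟩
  3 * (3 * b + 5 * (b + x)) + 5 * (3 * (b + x) + 5 * (b + x + y))
    ≡⟨ cong₂ (λ p q → 3 * (3 * b + 5 * p) + 5 * (3 * p + 5 * (q + y)))
         (weightBelow-suc d k) (weightBelow-suc d k) ⟨
  3 * (3 * b + 5 * b′) + 5 * (3 * b′ + 5 * (b′ + y))
    ≡⟨ cong (λ p → 3 * (3 * b + 5 * b′) + 5 * (3 * b′ + 5 * p)) (weightBelow-suc d (suc k)) ⟨
  3 * (3 * b + 5 * b′) + 5 * (3 * b′ + 5 * weightBelow d (suc (suc k)))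
    ≡⟨⟩
  weightBelow (suc (suc d)) (suc (suc k)) ∎
  where
  open ≤-Reasoning
  d = suc (k * 2)
  b = weightBelow d k
  b′ = weightBelow d (suc k)
  x = weight d k
  y = weight d (suc k)
  split : ∀ b x → 64 * (b + x) + 6 * x ≡ 64 * b + 55 * x + 5 * (3 * x)
  split = solve-∀
  unstep : ∀ b x y → 64 * b + 55 * x + 5 * (5 * y)
    ≡ 3 * (3 * b + 5 * (b + x)) + 5 * (3 * (b + x) + 5 * (b + x + y))
  unstep = solve-∀

-- The offset 11 makes 23 the first number of trials. Each further pair of trials multiplies the
-- total weight by 64, which `lowerHalf-step` matches.
lowerHalf-odd : ∀ m → Likely (suc ((m + 11) * 2)) (suc (m + 11))
-- With 23 and 12 as arguments, the conversion check would evaluate weightBelow 23 12.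
lowerHalf-odd zero    =
  scaledBelow⇒Likely (suc ((zero + 11) * 2)) (suc (zero + 11)) (≤ᵇ⇒≤ _ _ tt)
lowerHalf-odd (suc m) = begin
  8 * (8 * 8 ^ suc (suc (k * 2)))                     ≡⟨ *-assoc 8 8 (8 ^ suc (suc (k * 2))) ⟨
  64 * 8 ^ suc (suc (k * 2))                          ≤⟨ *-monoʳ-≤ 64 (lowerHalf-odd m) ⟩
  64 * (9 * weightBelow (suc (k * 2)) (suc k))        ≡⟨ swap (weightBelow (suc (k * 2)) (suc k)) ⟩
  9 * (64 * weightBelow (suc (k * 2)) (suc k))        ≤⟨ *-monoʳ-≤ 9 (lowerHalf-step k) ⟩
  9 * weightBelow (suc (suc k * 2)) (suc (suc k))     ∎
  where
  open ≤-Reasoning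
  k = m + 11
  swap : ∀ x → 64 * (9 * x) ≡ 9 * (64 * x)
  swap = solve-∀

-- At most k successes in 2k + 1 trials leave at most k in 2k of them, so dropping a trial keeps the
-- bound.
lowerHalf-even : ∀ m → Likely ((m + 11) * 2) (suc (m + 11))
lowerHalf-even m = *-cancelˡ-≤ 8 (begin
  8 * 8 ^ suc (k * 2)                                 ≤⟨ lowerHalf-odd m ⟩
  9 * (3 * weightBelow (k * 2) k + 5 * w)
    ≤⟨ *-monoʳ-≤ 9 (+-monoˡ-≤ (5 * w) (*-monoʳ-≤ 3 (weightBelow-mono (k * 2) k))) ⟩
  9 * (3 * w + 5 * w)                                 ≡⟨ collect w ⟩
  8 * (9 * w)                                         ∎)
  where
  open ≤-Reasoning
  k = m + 11
  w = weightBelow (k * 2) (suc k)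
  collect : ∀ w → 9 * (3 * w + 5 * w) ≡ 8 * (9 * w)
  collect = solve-∀

parity : ∀ d → Σ[ k ∈ ℕ ] (d ≡ k * 2 ⊎ d ≡ suc (k * 2))
parity zero = 0 , inj₁ refl
parity (suc d) with parity d
... | k , inj₁ refl = k , inj₂ refl
... | k , inj₂ refl = suc k , inj₁ refl

-- Hides the parity of `d`: one cut-off `j` serves both stability and the probability bound.
HalfThreshold : ℕ → Set
HalfThreshold d = Σ[ j ∈ ℕ ] ((∀ {i} → i < j → 2 * i ≤ d) × Likely d j)

double-mono : ∀ {i k} → i ≤ k → 2 * i ≤ k * 2
double-mono {i} i≤k = ≤-trans (≤-reflexive (*-comm 2 i)) (*-monoˡ-≤ 2 i≤k)

-- The cut-off is ⌊d/2⌋ + 1 for d = `e + 22`, the extra 1 because it is strict. Half of 22 is the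
-- offset 11.
halfThreshold : ∀ e → HalfThreshold (e + 22)
halfThreshold e with parity e
... | m , inj₁ refl = subst HalfThreshold (*-distribʳ-+ 2 m 11)
  (suc (m + 11) , (λ { (s≤s i≤k) → double-mono i≤k }) , lowerHalf-even m)
... | m , inj₂ refl = subst HalfThreshold (cong suc (*-distribʳ-+ 2 m 11))
  (suc (m + 11) , (λ { (s≤s i≤k) → m≤n⇒m≤1+n (double-mono i≤k) }) , lowerHalf-odd m)

-- Weighted sums over all subsets

-- 8 ^ n times the expectation of `f` at the random set.
𝔼 : ∀ {n} → (Subset n → ℕ) → ℕ
𝔼 {zero}  f = f []
𝔼 {suc n} f = 3 * 𝔼 (λ A → f (inside ∷ A)) + 5 * 𝔼 (λ A → f (outside ∷ A))

𝔼-cong : ∀ {n} {f g : Subset n → ℕ} → (∀ A → f A ≡ g A) → 𝔼 f ≡ 𝔼 g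
𝔼-cong {zero}  f≗g = f≗g []
𝔼-cong {suc n} f≗g = cong₂ (λ x y → 3 * x + 5 * y)
  (𝔼-cong (f≗g ∘ (inside ∷_))) (𝔼-cong (f≗g ∘ (outside ∷_)))

𝔼-zero : ∀ n → 𝔼 {n} (λ _ → 0) ≡ 0
𝔼-zero zero    = refl
𝔼-zero (suc n) = cong (λ x → 3 * x + 5 * x) (𝔼-zero n)

𝔼-+ : ∀ {n} (f g : Subset n → ℕ) → 𝔼 (λ A → f A + g A) ≡ 𝔼 f + 𝔼 g
𝔼-+ {zero}  f g = refl
𝔼-+ {suc n} f g = trans
  (cong₂ (λ x y → 3 * x + 5 * y) (𝔼-+ (f ∘ (inside ∷_)) (g ∘ (inside ∷_)))
                                 (𝔼-+ (f ∘ (outside ∷_)) (g ∘ (outside ∷_))))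
  (regroup (𝔼 (f ∘ (inside ∷_))) (𝔼 (g ∘ (inside ∷_)))
           (𝔼 (f ∘ (outside ∷_))) (𝔼 (g ∘ (outside ∷_))))
  where
  regroup : ∀ a x b y → 3 * (a + x) + 5 * (b + y) ≡ (3 * a + 5 * b) + (3 * x + 5 * y)
  regroup = solve-∀

-- Method of conditional expectations: elements are decided one by one, keeping the average at least
-- c / k. If both branches fell short, so would their weighted mean.
𝔼-attained : ∀ {n} k c (f : Subset n → ℕ) → c * 8 ^ n ≤ k * 𝔼 f → Σ[ A ∈ Subset n ] c ≤ k * f A
𝔼-attained {zero}  k c f c≤ = [] , subst (_≤ k * f []) (*-identityʳ c) c≤
𝔼-attained {suc n} k c f c≤
  with c * 8 ^ n ≤? k * 𝔼 (f ∘ (inside ∷_)) | c * 8 ^ n ≤? k * 𝔼 (f ∘ (outside ∷_))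
... | yes p | _     = let A , q = 𝔼-attained k c (f ∘ (inside ∷_)) p in inside ∷ A , q
... | no _  | yes p = let A , q = 𝔼-attained k c (f ∘ (outside ∷_)) p in outside ∷ A , q
... | no ¬p | no ¬q = ⊥-elim (<-irrefl refl (begin-strict
  c * (8 * 8 ^ n)                      ≤⟨ c≤ ⟩
  k * (3 * x + 5 * y)                  ≡⟨ distr k x y ⟩
  3 * (k * x) + 5 * (k * y)            <⟨ +-mono-< (*-monoʳ-< 3 (≰⇒> ¬p)) (*-monoʳ-< 5 (≰⇒> ¬q)) ⟩
  3 * (c * 8 ^ n) + 5 * (c * 8 ^ n)    ≡⟨ collect c (8 ^ n) ⟩
  c * (8 * 8 ^ n)                      ∎))
  where
  open ≤-Reasoning
  x = 𝔼 (f ∘ (inside ∷_))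
  y = 𝔼 (f ∘ (outside ∷_))
  distr : ∀ k x y → k * (3 * x + 5 * y) ≡ 3 * (k * x) + 5 * (k * y)
  distr = solve-∀
  collect : ∀ c p → 3 * (c * p) + 5 * (c * p) ≡ c * (8 * p)
  collect = solve-∀

-- Expected cardinalities and the law of `∣ S ∩ A ∣`

𝟙 : Bool → ℕ
𝟙 true  = 1
𝟙 false = 0

∣tabulate∣-suc : ∀ {m} (f : Fin (suc m) → Bool) →
  ∣ tabulate f ∣ ≡ 𝟙 (f zero) + ∣ tabulate (f ∘ suc) ∣
∣tabulate∣-suc f with f zero
... | true  = refl
... | false = refl

-- Linearity of expectation: a cardinality is a sum of indicators.
𝔼-∣tabulate∣ : ∀ {n m} k c (f : Subset n → Fin m → Bool) →
  (∀ v → c ≤ k * 𝔼 (λ A → 𝟙 (f A v))) → m * c ≤ k * 𝔼 (λ A → ∣ tabulate (f A) ∣)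
𝔼-∣tabulate∣ {m = zero}  k c f h = z≤n
𝔼-∣tabulate∣ {m = suc m} k c f h = begin
  c + m * c
    ≤⟨ +-mono-≤ (h zero) (𝔼-∣tabulate∣ k c (λ A → f A ∘ suc) (h ∘ suc)) ⟩
  k * 𝔼 (λ A → 𝟙 (f A zero)) + k * 𝔼 (λ A → ∣ tabulate (f A ∘ suc) ∣)
    ≡⟨ *-distribˡ-+ k _ _ ⟨
  k * (𝔼 (λ A → 𝟙 (f A zero)) + 𝔼 (λ A → ∣ tabulate (f A ∘ suc) ∣))
    ≡⟨ cong (k *_) (𝔼-+ (λ A → 𝟙 (f A zero)) (λ A → ∣ tabulate (f A ∘ suc) ∣)) ⟨
  k * 𝔼 (λ A → 𝟙 (f A zero) + ∣ tabulate (f A ∘ suc) ∣)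
    ≡⟨ cong (k *_) (𝔼-cong (λ A → ∣tabulate∣-suc (f A))) ⟨
  k * 𝔼 (λ A → ∣ tabulate (f A) ∣) ∎
  where open ≤-Reasoning

-- `∣ S ∩ A ∣` has law Bin(∣S∣, 3/8): choosing an element of `S` lowers the cut-off by one, and an
-- element outside `S` only contributes a factor 8. Powers of 8 on both sides avoid a subtraction in
-- the exponent.
𝔼-small : ∀ {n} (S : Subset n) j →
  𝔼 (λ A → 𝟙 (∣ S ∩ A ∣ <ᵇ j)) * 8 ^ ∣ S ∣ ≡ 8 ^ n * weightBelow ∣ S ∣ j
𝔼-small {n} S zero = trans (cong (_* 8 ^ ∣ S ∣) (𝔼-zero n)) (sym (*-zeroʳ (8 ^ n)))
𝔼-small [] (suc j) = refl
𝔼-small {suc n} (inside ∷ S) (suc j) = trans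
  (expand (𝔼 (λ A → 𝟙 (∣ S ∩ A ∣ <ᵇ j))) (𝔼 (λ A → 𝟙 (∣ S ∩ A ∣ <ᵇ suc j))) (8 ^ ∣ S ∣))
  (trans (cong₂ (λ x y → 8 * (3 * x + 5 * y)) (𝔼-small S j) (𝔼-small S (suc j)))
         (collect (8 ^ n) (weightBelow ∣ S ∣ j) (weightBelow ∣ S ∣ (suc j))))
  where
  expand : ∀ x y p → (3 * x + 5 * y) * (8 * p) ≡ 8 * (3 * (x * p) + 5 * (y * p))
  expand = solve-∀
  collect : ∀ q a b → 8 * (3 * (q * a) + 5 * (q * b)) ≡ 8 * q * (3 * a + 5 * b)
  collect = solve-∀
𝔼-small {suc n} (outside ∷ S) (suc j) = trans
  (expand (𝔼 (λ A → 𝟙 (∣ S ∩ A ∣ <ᵇ suc j))) (8 ^ ∣ S ∣))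
  (trans (cong (8 *_) (𝔼-small S (suc j))) (sym (*-assoc 8 (8 ^ n) _)))
  where
  expand : ∀ x p → (3 * x + 5 * x) * p ≡ 8 * (x * p)
  expand = solve-∀

-- As `v` is not in `S`, its membership in `A` is independent of `∣ S ∩ A ∣` and costs a factor 3/8.
𝔼-small-∋ : ∀ {n} (S : Subset n) v j → v ∉ S →
  𝔼 (λ A → 𝟙 ((∣ S ∩ A ∣ <ᵇ j) ∧ lookup A v)) * 8 ^ suc ∣ S ∣ ≡ 3 * 8 ^ n * weightBelow ∣ S ∣ j
𝔼-small-∋ {n} S v zero v∉S =
  trans (cong (_* 8 ^ suc ∣ S ∣) (𝔼-zero n)) (sym (*-zeroʳ (3 * 8 ^ n)))
𝔼-small-∋ (inside ∷ S) zero j v∉S = ⊥-elim (v∉S here)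
-- Here `v` itself is decided: leaving it out contributes nothing, and putting it in reduces to
-- `𝔼-small`.
𝔼-small-∋ {suc n} (outside ∷ S) zero j@(suc _) v∉S = begin
  (3 * 𝔼 (λ A → 𝟙 ((∣ S ∩ A ∣ <ᵇ j) ∧ true)) + 5 * 𝔼 (λ A → 𝟙 ((∣ S ∩ A ∣ <ᵇ j) ∧ false))) * (8 * p)
    ≡⟨ cong₂ (λ x y → (3 * x + 5 * y) * (8 * p))
         (𝔼-cong (λ A → cong 𝟙 (∧-identityʳ (∣ S ∩ A ∣ <ᵇ j))))
         (trans (𝔼-cong (λ A → cong 𝟙 (∧-zeroʳ (∣ S ∩ A ∣ <ᵇ j)))) (𝔼-zero n)) ⟩
  (3 * 𝔼 (λ A → 𝟙 (∣ S ∩ A ∣ <ᵇ j)) + 5 * 0) * (8 * p)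
    ≡⟨ expand (𝔼 (λ A → 𝟙 (∣ S ∩ A ∣ <ᵇ j))) p ⟩
  24 * (𝔼 (λ A → 𝟙 (∣ S ∩ A ∣ <ᵇ j)) * p)
    ≡⟨ cong (24 *_) (𝔼-small S j) ⟩
  24 * (8 ^ n * weightBelow ∣ S ∣ j)
    ≡⟨ collect (8 ^ n) (weightBelow ∣ S ∣ j) ⟩
  3 * 8 ^ suc n * weightBelow ∣ S ∣ j ∎
  where
  open ≡-Reasoning
  p = 8 ^ ∣ S ∣
  expand : ∀ x p → (3 * x + 5 * 0) * (8 * p) ≡ 24 * (x * p)
  expand = solve-∀
  collect : ∀ q w → 24 * (q * w) ≡ 3 * (8 * q) * w
  collect = solve-∀
𝔼-small-∋ {suc n} (inside ∷ S) (suc v) (suc j) v∉S = trans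
  (expand (𝔼 (λ A → 𝟙 ((∣ S ∩ A ∣ <ᵇ j) ∧ lookup A v)))
          (𝔼 (λ A → 𝟙 ((∣ S ∩ A ∣ <ᵇ suc j) ∧ lookup A v))) (8 ^ ∣ S ∣))
  (trans (cong₂ (λ x y → 8 * (3 * x + 5 * y))
           (𝔼-small-∋ S v j (v∉S ∘ there)) (𝔼-small-∋ S v (suc j) (v∉S ∘ there)))
         (collect (8 ^ n) (weightBelow ∣ S ∣ j) (weightBelow ∣ S ∣ (suc j))))
  where
  expand : ∀ x y p → (3 * x + 5 * y) * (8 * (8 * p)) ≡ 8 * (3 * (x * (8 * p)) + 5 * (y * (8 * p)))
  expand = solve-∀
  collect : ∀ q a b → 8 * (3 * (3 * q * a) + 5 * (3 * q * b)) ≡ 3 * (8 * q) * (3 * a + 5 * b)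
  collect = solve-∀
𝔼-small-∋ {suc n} (outside ∷ S) (suc v) (suc j) v∉S = trans
  (expand (𝔼 (λ A → 𝟙 ((∣ S ∩ A ∣ <ᵇ suc j) ∧ lookup A v))) (8 ^ ∣ S ∣))
  (trans (cong (8 *_) (𝔼-small-∋ S v (suc j) (v∉S ∘ there)))
         (collect (8 ^ n) (weightBelow ∣ S ∣ (suc j))))
  where
  expand : ∀ x p → (3 * x + 5 * x) * (8 * p) ≡ 8 * (x * (8 * p))
  expand = solve-∀
  collect : ∀ q w → 8 * (3 * q * w) ≡ 3 * (8 * q) * w
  collect = solve-∀

-- Multiplies the two independent probabilities: 3/8 · 8/9 = 1/3.
𝔼-small-∋-≥ : ∀ {n} (S : Subset n) v j → v ∉ S → Likely ∣ S ∣ j →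
  8 ^ n ≤ 3 * 𝔼 (λ A → 𝟙 ((∣ S ∩ A ∣ <ᵇ j) ∧ lookup A v))
𝔼-small-∋-≥ {n} S v j v∉S h = *-cancelʳ-≤ _ _ (8 ^ suc ∣ S ∣) {{m^n≢0 8 (suc ∣ S ∣)}} (begin
  8 ^ n * 8 ^ suc ∣ S ∣                  ≤⟨ *-monoʳ-≤ (8 ^ n) h ⟩
  8 ^ n * (9 * weightBelow ∣ S ∣ j)      ≡⟨ regroup (8 ^ n) (weightBelow ∣ S ∣ j) ⟩
  3 * (3 * 8 ^ n * weightBelow ∣ S ∣ j)  ≡⟨ cong (3 *_) (𝔼-small-∋ S v j v∉S) ⟨
  3 * (e * 8 ^ suc ∣ S ∣)                ≡⟨ *-assoc 3 e _ ⟨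
  3 * e * 8 ^ suc ∣ S ∣                  ∎)
  where
  open ≤-Reasoning
  e = 𝔼 (λ A → 𝟙 ((∣ S ∩ A ∣ <ᵇ j) ∧ lookup A v))
  regroup : ∀ q w → q * (9 * w) ≡ 3 * (3 * q * w)
  regroup = solve-∀

-- Construction of the stable set

∧-true : ∀ a {b} → a ∧ b ≡ true → a ≡ true × b ≡ true
∧-true true eq = refl , eq

theorem6 : ∀ (n : ℕ) (G : Digraph n) → MinOutdegree≥ G 22 →
    Σ[ T ∈ Subset n ] (Stable G T × n ≤ 3 * ∣ T ∣)
theorem6 n G δ≥22 = T , stable , proj₂ attained
  where
  threshold : ∀ v → HalfThreshold (outdegree G v)
  threshold v = subst HalfThreshold (m∸n+n≡m (δ≥22 v)) (halfThreshold (outdegree G v ∸ 22))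

  keep : Subset n → Fin n → Bool
  keep A v = (∣ outNbrs G v ∩ A ∣ <ᵇ proj₁ (threshold v)) ∧ lookup A v

  attained : Σ[ A ∈ Subset n ] n ≤ 3 * ∣ tabulate (keep A) ∣
  -- The bound 8 ^ n for each of the `n` vertices adds up to `n * 8 ^ n`, hence the average n / 3.
  attained = 𝔼-attained 3 n (λ A → ∣ tabulate (keep A) ∣)
    (𝔼-∣tabulate∣ 3 (8 ^ n) keep (λ v →
      𝔼-small-∋-≥ (outNbrs G v) v (proj₁ (threshold v)) (loopless G v) (proj₂ (proj₂ (threshold v)))))

  A T : Subset n
  A = proj₁ attained
  T = tabulate (keep A)

  kept : ∀ {v} → v ∈ T → (∣ outNbrs G v ∩ A ∣ <ᵇ proj₁ (threshold v)) ≡ true × lookup A v ≡ true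
  kept {v} v∈T = ∧-true _ (trans (sym (lookup∘tabulate (keep A) v)) ([]=⇒lookup v∈T))

  T⊆A : T ⊆ A
  T⊆A {v} v∈T = lookup⇒[]= v A (proj₂ (kept v∈T))

  stable : Stable G T
  -- Shrinking `A` to `T` only lowers the count of out-neighbours, so it stays below the cut-off
  -- that `v` passed.
  stable v v∈T = proj₁ (proj₂ (threshold v)) (≤-<-trans (p⊆q⇒∣p∣≤∣q∣ N∩T⊆N∩A)
    (<ᵇ⇒< _ _ (subst So (sym (proj₁ (kept v∈T))) tt)))
    where
    N∩T⊆N∩A : outNbrs G v ∩ T ⊆ outNbrs G v ∩ A
    N∩T⊆N∩A u∈ = let u∈N , u∈T = x∈p∩q⁻ (outNbrs G v) T u∈ in x∈p∩q⁺ (u∈N , T⊆A u∈T)
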